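{- Let $G$ be an equiarboreal graph. Then $G$ is resistance regular if and only if $G$ is degree regular.
   Context: All graphs are finite, simple, undirected and connected. A connected graph $G$ is equiarboreal if the number of spanning trees of $G$ containing a given edge is independent of the choice of the edge. $G$ is degree regular if all its vertex degrees are equal. The resistance distance $r_{ij}$ is the effective resistance between vertices $i$ and $j$ when each edge of $G$ carries a unit resistance; equivalently (known fact) $r_{ij}=L_{ii}^++L_{jj}^+-2L_{ij}^+$, where $L^+$ is the Moore-Penrose inverse of the Laplacian matrix $L=D-A$ of $G$. The resistance matrix is $R(G)=(r_{ij})$; $G$ is resistance regular if all row sums of $R(G)$ are equal. -}

module Defs where

open import Data.Bool.Base using (if_then_else_)
open import Data.Fin.Base using (Fin)
open import Data.Fin.Properties using (_≟_; _<?_)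
open import Data.Fin.Subset using (Subset) renaming (_∈_ to _∈ₛ_)
open import Data.List.Base
  using (List; []; _∷_; _++_; length; lookup; filter; allFin; cartesianProduct)
open import Data.List.Membership.Propositional using (_∈_)
open import Data.List.Relation.Unary.Linked using (Linked)
open import Data.List.Relation.Unary.Unique.Propositional using (Unique)
open import Data.Nat.Base using (ℕ; NonZero; _≤_)
open import Data.Product.Base using (∃-syntax; _×_; _,_)
open import Data.Rational.Base using (ℚ; 0ℚ; 1ℚ; _-_)
open import Data.Rational.Properties using (+-0-commutativeMonoid)
open import Data.Sum.Base using (_⊎_)
open import Data.Vec.Functional using (Vector)
open import Function.Bundles using (_⇔_)
open import Level using (0ℓ)
open import Relation.Binary.Construct.Closure.ReflexiveTransitive using (Star)
open import Relation.Binary.Core using (Rel)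
open import Relation.Binary.Definitions using (Decidable; Symmetric; Irreflexive)
open import Relation.Binary.PropositionalEquality.Core using (_≡_)
open import Relation.Nullary.Decidable using (does; _×-dec_)
open import Relation.Nullary.Negation.Core using (¬_)
open import Relation.Unary using (Pred)
open import Algebra.Properties.CommutativeMonoid.Sum +-0-commutativeMonoid
  using (sum)

record Graph (n : ℕ) : Set₁ where
  infix 4 _~_ _~?_
  field
    _~_    : Rel (Fin n) 0ℓ
    _~?_   : Decidable _~_
    symm   : Symmetric _~_
    irrefl : Irreflexive _≡_ _~_

-- The graph with no vertices is not counted as connected.
record IsConnected {n} (_~_ : Rel (Fin n) 0ℓ) : Set where
  field
    nonEmpty : NonZero n
    walk     : ∀ u v → Star _~_ u v

-- A cycle v, v₁, …, vₖ, v with k ≥ 2 and v, v₁, …, vₖ distinct.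
IsCycle : ∀ {n} → Rel (Fin n) 0ℓ → Fin n → List (Fin n) → Set
IsCycle _~_ v vs =
  Linked _~_ (v ∷ vs ++ v ∷ []) × Unique (v ∷ vs) × 2 ≤ length vs

IsAcyclic : ∀ {n} → Rel (Fin n) 0ℓ → Set
IsAcyclic _~_ = ∀ v vs → ¬ IsCycle _~_ v vs

-- P has exactly k elements: they can be listed without repetition in a list of
-- length k.
HasCardinality : {A : Set} → Pred A 0ℓ → ℕ → Set
HasCardinality {A} P k =
  ∃[ xs ] (Unique {A = A} xs × (∀ x → x ∈ xs ⇔ P x) × length xs ≡ k)

δ : ∀ {n} → Fin n → Vector ℚ n
δ i u = if does (i ≟ u) then 1ℚ else 0ℚ

module _ {n} (G : Graph n) where
  open Graph G

  Connected : Set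
  Connected = IsConnected _~_

  degree : Fin n → ℕ
  degree u = length (filter (u ~?_) (allFin n))

  DegreeRegular : Set
  DegreeRegular = ∀ u v → degree u ≡ degree v

  -- Each undirected edge occurs once, as the pair (u , v) with u < v.
  edges : List (Fin n × Fin n)
  edges = filter (λ (u , v) → (u <? v) ×-dec (u ~? v))
                 (cartesianProduct (allFin n) (allFin n))

  Edge : Set
  Edge = Fin (length edges)

  -- A set of edges is identified with the subgraph that has these edges and
  -- all the vertices of G; this is the adjacency relation of that subgraph.
  SpannedBy : Subset (length edges) → Rel (Fin n) 0ℓ
  SpannedBy T u v =
    ∃[ e ] (e ∈ₛ T × (lookup edges e ≡ (u , v) ⊎ lookup edges e ≡ (v , u)))

  IsSpanningTree : Subset (length edges) → Set
  IsSpanningTree T = IsConnected (SpannedBy T) × IsAcyclic (SpannedBy T)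

  Equiarboreal : Set
  Equiarboreal =
    ∃[ k ] (∀ (e : Edge) → HasCardinality (λ T → IsSpanningTree T × e ∈ₛ T) k)

  -- The net current leaving u when the vertices are held at the potentials φ
  -- and every edge is a unit resistor (Ohm's law).
  outflow : Vector ℚ n → Vector ℚ n
  outflow φ u = sum λ w → if does (u ~? w) then φ u - φ w else 0ℚ

  -- r is the potential difference between i and j when a unit current enters
  -- the network at i and leaves it at j (Kirchhoff's current law).  The
  -- equations for φ have integer coefficients, so rational potentials suffice.
  IsEffectiveResistance : Fin n → Fin n → ℚ → Set
  IsEffectiveResistance i j r =
    ∃[ φ ] ((∀ u → outflow φ u ≡ δ i u - δ j u) × r ≡ φ i - φ j)

  IsResistanceMatrix : (Fin n → Fin n → ℚ) → Set
  IsResistanceMatrix R = ∀ i j → IsEffectiveResistance i j (R i j)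

  -- A connected graph has exactly one resistance matrix R.
  ResistanceRegular : Set
  ResistanceRegular =
    ∃[ R ] (IsResistanceMatrix R × (∀ i j → sum (R i) ≡ sum (R j)))

{-# OPTIONS --safe #-}

-- Let τ be the number of spanning trees, and f u j the number of two-component
-- spanning forests that separate u from j.  Cutting the first edge of the path
-- from u to j in a spanning tree shows that, for u ≠ j, exactly τ pairs of a
-- neighbour w of u and a two-component forest have u alone in one component and
-- w, j in the other.  With the triangle relation between f u j, f u w and f w j
-- this says that L f(·, j) at u, L being the Laplacian, is 2τ(1 − δ j u) − Σ_{w ~ u} f u w, and f u w is
-- the number of spanning trees through the edge uw when u ~ w.  Hence f/τ is the
-- resistance matrix (uniqueness is the maximum principle), and if every edge lies
-- in κ spanning trees, the row sums ρ of f satisfy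
--   (L ρ)(u) = 2τ(n − 1) − n κ deg u.
-- If ρ is constant and n > 1, then n κ deg u = 2τ(n − 1) ≠ 0 for all u, so the
-- degrees are equal.  If the degrees are equal, L ρ is constant; since its entries sum to 0, it vanishes, so ρ is
-- harmonic and therefore constant.
module Submission where

open import Algebra.Bundles using (CommutativeRing)
open import Data.Bool.Base using (if_then_else_)
import Data.Bool.Properties as Bool
open import Data.Fin.Base using (Fin; zero; suc; _<_)
open import Data.Fin.Properties
  using (_≟_; _<?_; <-cmp; <-asym; all?; any?; ¬∀⟶∃¬)
open import Data.Fin.Subset
  using (Subset; inside; outside; ⊤; _⊆_; _⊂_) renaming (_∈_ to _∈ₛ_)
open import Data.Fin.Subset.Induction using (⊂-wellFounded)
open import Data.Fin.Subset.Properties using (_∈?_; drop-there; ∈⊤)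
open import Data.List.Base
  using (List; []; _∷_; _++_; length; lookup; filter; allFin; tabulate; cartesianProduct)
import Data.List.Extrema as Extrema
import Data.List.Membership.DecPropositional as DecMembership
open import Data.List.Membership.Propositional using (_∈_)
open import Data.List.Membership.Propositional.Properties
  using (∈-lookup; ∈-filter⁺; ∈-filter⁻; ∈-cartesianProduct⁺; ∈-allFin)
open import Data.List.Relation.Unary.All as All using (All; []; _∷_)
open import Data.List.Relation.Unary.AllPairs using ([]; _∷_)
open import Data.List.Relation.Unary.Any as Any using (here; there; index)
open import Data.List.Relation.Unary.Any.Properties using (lookup-index)
open import Data.List.Relation.Unary.Linked as Linked using (Linked; [-]; _∷_)
open import Data.List.Relation.Unary.Unique.Propositional using (Unique)
open import Data.List.Relation.Unary.Unique.Propositional.Properties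
  using (filter⁺; cartesianProduct⁺; allFin⁺)
open import Data.Nat.Base as ℕ using (ℕ; zero; suc; z≤n; s≤s)
open import Data.Product.Base using (∃-syntax; _×_; _,_; proj₁; proj₂)
open import Data.Product.Properties using () renaming (≡-dec to ×-≡-dec)
open import Data.Rational.Base
  using (ℚ; 0ℚ; 1ℚ; _+_; _*_; _-_; -_; 1/_; _≤_; ≢-nonZero)
open import Data.Rational.Properties
  using (≤-antisym; ≤-refl; ≤-trans; ≤-reflexive; ≤-decTotalOrder; nonNegative⁻¹;
         +-mono-≤; +-monoˡ-≤; +-monoʳ-≤; +-comm; +-identityˡ; +-identityʳ; +-inverseʳ;
         *-comm; *-assoc; *-identityˡ; *-identityʳ; *-zeroˡ; *-zeroʳ; *-inverseˡ;
         +-0-monoid; +-0-group; +-0-commutativeMonoid; +-*-commutativeRing)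
  renaming (_≟_ to _≟ℚ_)
open import Data.Rational.Solver using (module +-*-Solver)
open import Data.Sum.Base using (_⊎_; inj₁; inj₂; map₁; swap)
open import Data.Vec.Base using ([]; _∷_; _[_]≔_; here; there)
open import Data.Vec.Properties
  using ([]=⇒lookup; lookup⇒[]=; []≔-minimal; lookup∘update; lookup∘update′)
  renaming (≡-dec to Vec-≡-dec)
open import Defs
open import Function.Base using (_∘_; id)
open import Function.Bundles using (_⇔_; mk⇔; Equivalence)
open import Function.Construct.Composition using (_⇔-∘_)
open import Induction.WellFounded using (Acc; acc)
open import Level using (0ℓ)
open import Relation.Binary.Bundles using (DecTotalOrder)
open import Relation.Binary.Construct.Closure.ReflexiveTransitive as Star
  using (Star; ε; _◅_; _◅◅_; reverse)
open import Relation.Binary.Core using (Rel; _⇒_)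
open import Relation.Binary.Definitions
  using (Decidable; DecidableEquality; Symmetric; tri<; tri≈; tri>)
open import Relation.Binary.PropositionalEquality
  using (_≡_; _≢_; refl; sym; trans; cong; cong₂; subst; module ≡-Reasoning)
open import Relation.Nullary.Decidable as Dec
  using (Dec; yes; no; does; map′; _×-dec_; _⊎-dec_; _→-dec_; ¬?; decidable-stable)
open import Relation.Nullary.Negation.Core using (¬_; contradiction)

open import Algebra.Properties.CommutativeMonoid.Sum +-0-commutativeMonoid
  using (sum; ∑-distrib-+; ∑-comm; sum-cong-≗; sum-replicate; sum-replicate-zero)
open import Algebra.Properties.Group +-0-group using (∙-cancelˡ; x∙y⁻¹≈ε⇒x≈y)
open import Algebra.Properties.Monoid.Mult +-0-monoid using () renaming (_×_ to _·_)
open import Algebra.Properties.Semiring.Sum (CommutativeRing.semiring +-*-commutativeRing)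
  using (*-distribˡ-sum; *-distribʳ-sum)
open +-*-Solver using (solve; _:=_; _:+_; _:*_; _:-_; con)

-- Connectivity and bridges

infixl 6 _∖_

_∖_ : ∀ {m} → Subset m → Fin m → Subset m
T ∖ e = T [ e ]≔ outside

module _ {m} {T : Subset m} where

  ∈-∖⁺ : ∀ {e x} → x ≢ e → x ∈ₛ T → x ∈ₛ T ∖ e
  ∈-∖⁺ x≢e = []≔-minimal T _ _ x≢e

  ∈-∖⁻ : ∀ {e x} → x ∈ₛ T ∖ e → x ∈ₛ T × x ≢ e
  ∈-∖⁻ {e} {x} x∈ with x ≟ e
  ... | yes refl =
    contradiction (trans (sym ([]=⇒lookup x∈)) (lookup∘update e T outside)) λ ()
  ... | no x≢e =
    lookup⇒[]= x T (trans (sym (lookup∘update′ x≢e T outside)) ([]=⇒lookup x∈)) , x≢e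

∖-⊆ : ∀ {m} {T : Subset m} {e} → T ∖ e ⊆ T
∖-⊆ = proj₁ ∘ ∈-∖⁻

∖-mono-⊆ : ∀ {m} {S T : Subset m} {e} → S ⊆ T → S ∖ e ⊆ T ∖ e
∖-mono-⊆ S⊆T x∈ = let x∈S , x≢e = ∈-∖⁻ x∈ in ∈-∖⁺ x≢e (S⊆T x∈S)

∖-swap-⊆ : ∀ {m} {T : Subset m} {e e′} → T ∖ e ∖ e′ ⊆ T ∖ e′ ∖ e
∖-swap-⊆ x∈ with ∈-∖⁻ x∈
... | x∈′ , x≢e′ with ∈-∖⁻ x∈′
... | x∈T , x≢e = ∈-∖⁺ x≢e (∈-∖⁺ x≢e′ x∈T)

-- Here `R` is `S` with at most one undirected edge between `a` and `b` added. A walk that crosses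
-- this edge repeatedly can be shortened: what lies between two crossings is dropped, so at most one
-- crossing remains.
Star-split : ∀ {A : Set} {R S : Rel A 0ℓ} {a b} →
  (∀ {x y} → R x y → S x y ⊎ (x ≡ a × y ≡ b) ⊎ (x ≡ b × y ≡ a)) →
  ∀ {x y} → Star R x y →
  Star S x y ⊎ (Star S x a × Star S b y) ⊎ (Star S x b × Star S a y)
Star-split split ε = inj₁ ε
Star-split split (r ◅ rs) with split r | Star-split split rs
... | inj₁ s                    | inj₁ p              = inj₁ (s ◅ p)
... | inj₁ s                    | inj₂ (inj₁ (p , q)) = inj₂ (inj₁ (s ◅ p , q))
... | inj₁ s                    | inj₂ (inj₂ (p , q)) = inj₂ (inj₂ (s ◅ p , q))
... | inj₂ (inj₁ (refl , refl)) | inj₁ p              = inj₂ (inj₁ (ε , p))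
... | inj₂ (inj₁ (refl , refl)) | inj₂ (inj₁ (_ , q)) = inj₂ (inj₁ (ε , q))
... | inj₂ (inj₁ (refl , refl)) | inj₂ (inj₂ (_ , q)) = inj₁ q
... | inj₂ (inj₂ (refl , refl)) | inj₁ p              = inj₂ (inj₂ (ε , p))
... | inj₂ (inj₂ (refl , refl)) | inj₂ (inj₁ (_ , q)) = inj₁ q
... | inj₂ (inj₂ (refl , refl)) | inj₂ (inj₂ (_ , q)) = inj₂ (inj₂ (ε , q))

Joins : ∀ {n m} → (Fin m → Fin n × Fin n) → Fin m → Rel (Fin n) 0ℓ
Joins g e u v = g e ≡ (u , v) ⊎ g e ≡ (v , u)

-- For `g` the list of edges of `G` this unfolds to `SpannedBy`. Allowing any `g`, loops and
-- parallel edges included, makes induction on the number of edges possible.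
Adj : ∀ {n m} → (Fin m → Fin n × Fin n) → Subset m → Rel (Fin n) 0ℓ
Adj g T u v = ∃[ e ] (e ∈ₛ T × Joins g e u v)

-- Induction on the number of edges: by `Star-split` a walk needs the first edge at most once, so
-- connectivity with it reduces to connectivities without it.
conn? : ∀ {n m} (g : Fin m → Fin n × Fin n) T → Decidable (Star (Adj g T))
conn? g [] x y = map′ (λ { refl → ε }) (λ { ε → refl }) (x ≟ y)
conn? g (outside ∷ T) x y = map′ (Star.map lift) (Star.map lower) (conn? (g ∘ suc) T x y)
  where
  lift : Adj (g ∘ suc) T ⇒ Adj g (outside ∷ T)
  lift (e , e∈T , j) = suc e , there e∈T , j
  lower : Adj g (outside ∷ T) ⇒ Adj (g ∘ suc) T
  lower (suc e , e∈T , j) = e , drop-there e∈T , j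
conn? g (inside ∷ T) x y =
  map′ glue (Star-split split)
    (conn? g′ T x y ⊎-dec (conn? g′ T x a ×-dec conn? g′ T b y)
                    ⊎-dec (conn? g′ T x b ×-dec conn? g′ T a y))
  where
  g′ = g ∘ suc
  a = proj₁ (g zero)
  b = proj₂ (g zero)
  split : ∀ {x y} → Adj g (inside ∷ T) x y →
          Adj g′ T x y ⊎ (x ≡ a × y ≡ b) ⊎ (x ≡ b × y ≡ a)
  split (zero , _ , inj₁ refl) = inj₂ (inj₁ (refl , refl))
  split (zero , _ , inj₂ refl) = inj₂ (inj₂ (refl , refl))
  split (suc e , e∈T , j)      = inj₁ (e , drop-there e∈T , j)
  lift : ∀ {x y} → Star (Adj g′ T) x y → Star (Adj g (inside ∷ T)) x y
  lift = Star.map λ { (e , e∈T , j) → suc e , there e∈T , j }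
  glue : ∀ {x y} → Star (Adj g′ T) x y ⊎ (Star (Adj g′ T) x a × Star (Adj g′ T) b y)
                   ⊎ (Star (Adj g′ T) x b × Star (Adj g′ T) a y) →
         Star (Adj g (inside ∷ T)) x y
  glue (inj₁ p)              = lift p
  glue (inj₂ (inj₁ (p , q))) = lift p ◅◅ (zero , here , inj₁ refl) ◅ lift q
  glue (inj₂ (inj₂ (p , q))) = lift p ◅◅ (zero , here , inj₂ refl) ◅ lift q

module _ {n m} (g : Fin m → Fin n × Fin n) where

  Conn : Subset m → Rel (Fin n) 0ℓ
  Conn T = Star (Adj g T)

  -- Acyclicity in a form that `conn?` decides and that deleting an edge visibly preserves;
  -- `acyclic⇔allBridges` compares it with the absence of cycles.
  AllBridges : Subset m → Set
  AllBridges T = ∀ e → e ∈ₛ T → ¬ Conn (T ∖ e) (proj₁ (g e)) (proj₂ (g e))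

  Tree : Subset m → Set
  Tree T = (∀ u v → Conn T u v) × AllBridges T

  -- T is a forest with exactly two components, one containing u and the other j.
  Separates : Subset m → Rel (Fin n) 0ℓ
  Separates T u j =
    AllBridges T × (∀ v → Conn T v u ⊎ Conn T v j) × ¬ Conn T u j

  bridge? : ∀ T e → Dec (e ∈ₛ T → ¬ Conn (T ∖ e) (proj₁ (g e)) (proj₂ (g e)))
  bridge? T e = (e ∈? T) →-dec ¬? (conn? g (T ∖ e) _ _)

  allBridges? : ∀ T → Dec (AllBridges T)
  allBridges? T = all? (bridge? T)

  abstract
    tree? : ∀ T → Dec (Tree T)
    tree? T = (all? λ u → all? λ v → conn? g T u v) ×-dec allBridges? T

    separates? : ∀ T u j → Dec (Separates T u j)
    separates? T u j = allBridges? T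
      ×-dec (all? λ v → conn? g T v u ⊎-dec conn? g T v j)
      ×-dec ¬? (conn? g T u j)

module _ {n m} {g : Fin m → Fin n × Fin n} where

  Joins-ends : ∀ {e x y u w} → Joins g e x y → Joins g e u w →
               (x ≡ u × y ≡ w) ⊎ (x ≡ w × y ≡ u)
  Joins-ends (inj₁ p) (inj₁ q) with trans (sym p) q
  ... | refl = inj₁ (refl , refl)
  Joins-ends (inj₁ p) (inj₂ q) with trans (sym p) q
  ... | refl = inj₂ (refl , refl)
  Joins-ends (inj₂ p) (inj₁ q) with trans (sym p) q
  ... | refl = inj₂ (refl , refl)
  Joins-ends (inj₂ p) (inj₂ q) with trans (sym p) q
  ... | refl = inj₁ (refl , refl)

  Conn-sym : ∀ {T} → Symmetric (Conn g T)
  Conn-sym = reverse λ { (e , e∈T , j) → e , e∈T , swap j }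

  Conn-mono : ∀ {S T} → S ⊆ T → Conn g S ⇒ Conn g T
  Conn-mono S⊆T = Star.map λ { (e , e∈S , j) → e , S⊆T e∈S , j }

  Conn-split : ∀ {T e u w} → Joins g e u w → ∀ {x y} → Conn g T x y →
    Conn g (T ∖ e) x y ⊎ (Conn g (T ∖ e) x u × Conn g (T ∖ e) w y)
                       ⊎ (Conn g (T ∖ e) x w × Conn g (T ∖ e) u y)
  Conn-split {T} {e} {u} {w} j = Star-split split
    where
    split : ∀ {x y} → Adj g T x y →
            Adj g (T ∖ e) x y ⊎ (x ≡ u × y ≡ w) ⊎ (x ≡ w × y ≡ u)
    split (f , f∈T , k) with f ≟ e
    ... | yes refl = inj₂ (Joins-ends k j)
    ... | no f≢e   = inj₁ (f , ∈-∖⁺ f≢e f∈T , k)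

  Conn-ends⁺ : ∀ {T e u w} → Joins g e u w → Conn g T (proj₁ (g e)) (proj₂ (g e)) → Conn g T u w
  Conn-ends⁺ (inj₁ eq) c = subst (λ (a , b) → Conn g _ a b) eq c
  Conn-ends⁺ (inj₂ eq) c = Conn-sym (subst (λ (a , b) → Conn g _ a b) eq c)

  Conn-ends⁻ : ∀ {T e u w} → Joins g e u w → Conn g T u w → Conn g T (proj₁ (g e)) (proj₂ (g e))
  Conn-ends⁻ (inj₁ eq) c = subst (λ (a , b) → Conn g _ a b) (sym eq) c
  Conn-ends⁻ (inj₂ eq) c = subst (λ (a , b) → Conn g _ a b) (sym eq) (Conn-sym c)

  bridge : ∀ {T e u w} → AllBridges g T → e ∈ₛ T → Joins g e u w → ¬ Conn g (T ∖ e) u w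
  bridge {e = e} br e∈T uw u~w = br e e∈T (Conn-ends⁻ uw u~w)

  AllBridges-∖ : ∀ {T e} → AllBridges g T → AllBridges g (T ∖ e)
  AllBridges-∖ br f f∈ c = br f (∖-⊆ f∈) (Conn-mono (∖-mono-⊆ ∖-⊆) c)

  -- Deleting `e` splits a tree into the side of `u` and the side of `w`, and the last hypothesis
  -- puts `j` on the side of `w`. Conversely, `e` reconnects the two components of such a forest.
  tree∖edge : ∀ {T e u w j} → Joins g e u w → e ∈ₛ T → Conn g (T ∖ e) w j →
              Tree g T ⇔ Separates g (T ∖ e) u j
  tree∖edge {T} {e} {u} {w} {j} uw e∈T w~j = mk⇔ to from
    where
    to : Tree g T → Separates g (T ∖ e) u j
    to (conn , br) = AllBridges-∖ br , side , λ u~j → bridge br e∈T uw (u~j ◅◅ Conn-sym w~j)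
      where
      side : ∀ v → Conn g (T ∖ e) v u ⊎ Conn g (T ∖ e) v j
      side v with Conn-split uw (conn v u)
      ... | inj₁ v~u              = inj₁ v~u
      ... | inj₂ (inj₁ (v~u , _)) = inj₁ v~u
      ... | inj₂ (inj₂ (v~w , _)) = inj₂ (v~w ◅◅ w~j)
    from : Separates g (T ∖ e) u j → Tree g T
    from (br , side , u≁j) = (λ x y → to-u x ◅◅ Conn-sym (to-u y)) , br′
      where
      u≁w : ¬ Conn g (T ∖ e) u w
      u≁w u~w = u≁j (u~w ◅◅ w~j)
      to-u : ∀ v → Conn g T v u
      to-u v with side v
      ... | inj₁ v~u = Conn-mono ∖-⊆ v~u
      ... | inj₂ v~j = Conn-mono ∖-⊆ (v~j ◅◅ Conn-sym w~j) ◅◅ (e , e∈T , swap uw) ◅ ε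
      -- Another edge `f` stays a bridge: a detour around `f` that avoids `e` contradicts the
      -- forest, and one through `e` yields, together with `f`, a walk from `u` to `w` avoiding `e`.
      br′ : AllBridges g T
      br′ f f∈T a~b with f ≟ e
      ... | yes refl = u≁w (Conn-ends⁺ uw a~b)
      ... | no f≢e with Conn-split uw a~b
      ...   | inj₁ a~b′ = br f (∈-∖⁺ f≢e f∈T) (Conn-mono ∖-swap-⊆ a~b′)
      ...   | inj₂ (inj₁ (a~u , w~b)) =
        u≁w (Conn-sym (shrink a~u) ◅◅ (f , ∈-∖⁺ f≢e f∈T , inj₁ refl) ◅ Conn-sym (shrink w~b))
        where shrink : ∀ {x y} → Conn g (T ∖ f ∖ e) x y → Conn g (T ∖ e) x y
              shrink = Conn-mono (∖-mono-⊆ ∖-⊆)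
      ...   | inj₂ (inj₂ (a~w , u~b)) =
        u≁w (shrink u~b ◅◅ (f , ∈-∖⁺ f≢e f∈T , inj₂ refl) ◅ shrink a~w)
        where shrink : ∀ {x y} → Conn g (T ∖ f ∖ e) x y → Conn g (T ∖ e) x y
              shrink = Conn-mono (∖-mono-⊆ ∖-⊆)

  separates⇒∉ : ∀ {T e u w j} → Joins g e u w → Separates g T u j → Conn g T w j → ¬ e ∈ₛ T
  separates⇒∉ uw (_ , _ , u≁j) w~j e∈T = u≁j ((_ , e∈T , uw) ◅ w~j)

  -- For a tree T, e is the first edge of the path from u to j, and w its far end.
  FirstEdge : Subset m → Fin n → Fin n → Fin n → Fin m → Set
  FirstEdge T u j w e = Joins g e u w × e ∈ₛ T × Conn g (T ∖ e) w j

  -- The witness is the edge by which a walk from `u` to `j` leaves `u` for the last time. The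
  -- remaining walk avoids `u`, hence also this edge.
  firstEdge-exists : ∀ {T u j} → u ≢ j → Conn g T u j → ∃[ w ] ∃[ e ] FirstEdge T u j w e
  firstEdge-exists {T} {u} {j} u≢j u~j with go u~j
    where
    Avoiding : Rel (Fin n) 0ℓ
    Avoiding x y = Adj g T x y × x ≢ u × y ≢ u
    avoid : ∀ {w e} → Joins g e u w → Avoiding ⇒ Adj g (T ∖ e)
    avoid uw ((f , f∈T , xy) , x≢u , y≢u) = f , ∈-∖⁺ f≢e f∈T , xy
      where
      f≢e : f ≢ _
      f≢e refl with Joins-ends xy uw
      ... | inj₁ (x≡u , _) = x≢u x≡u
      ... | inj₂ (_ , y≡u) = y≢u y≡u
    go : ∀ {x} → Conn g T x j →
         (∃[ w ] ∃[ e ] FirstEdge T u j w e) ⊎ (x ≢ u × Star Avoiding x j)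
    go ε = inj₂ (u≢j ∘ sym , ε)
    go {x} ((e , e∈T , xy) ◅ y~j) with go y~j
    ... | inj₁ found = inj₁ found
    ... | inj₂ (y≢u , y~j′) with x ≟ u
    ...   | yes refl = inj₁ (_ , e , xy , e∈T , Star.map (avoid xy) y~j′)
    ...   | no x≢u   = inj₂ (x≢u , ((e , e∈T , xy) , x≢u , y≢u) ◅ y~j′)
  ... | inj₁ found     = found
  ... | inj₂ (u≢u , _) = contradiction refl u≢u

  -- If `e` and `e′` differ, then `e′` followed by the walk from `w′` to `j` leads from `u` to `j`
  -- without `e`, although `e` is a bridge between them.
  firstEdge-unique : ∀ {T u j w w′ e e′} → AllBridges g T →
    FirstEdge T u j w e → FirstEdge T u j w′ e′ → w ≡ w′
  firstEdge-unique {T} {u} {j} {w} {w′} {e} {e′} br (uw , e∈T , w~j) (uw′ , e′∈T , w′~j)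
    with e ≟ e′
  ... | yes refl with Joins-ends uw uw′
  ...   | inj₁ (_ , w≡w′)   = w≡w′
  ...   | inj₂ (refl , w≡u) = w≡u
  firstEdge-unique {T} {u} {j} {w} {w′} {e} {e′} br (uw , e∈T , w~j) (uw′ , e′∈T , w′~j)
      | no e≢e′ = contradiction
    ((e′ , ∈-∖⁺ (e≢e′ ∘ sym) e′∈T , uw′) ◅ Conn-mono (∖-mono-⊆ ∖-⊆) (avoid w′~j)) u≁j
    where
    u≁j : ¬ Conn g (T ∖ e) u j
    u≁j u~j = bridge br e∈T uw (u~j ◅◅ Conn-sym w~j)
    u≁j′ : ¬ Conn g (T ∖ e′) u j
    u≁j′ u~j = bridge br e′∈T uw′ (u~j ◅◅ Conn-sym w′~j)
    -- The walk to `j` cannot use `e`: it would then pass through `u`, which does not reach `j` once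
    -- `e′` is deleted.
    avoid : ∀ {x} → Conn g (T ∖ e′) x j → Conn g (T ∖ e′ ∖ e) x j
    avoid ε = ε
    avoid ((f , f∈ , xy) ◅ y~j) with f ≟ e
    ... | no f≢e = (f , ∈-∖⁺ f≢e f∈ , xy) ◅ avoid y~j
    ... | yes refl with Joins-ends xy uw
    ...   | inj₁ (refl , _) = contradiction ((f , f∈ , xy) ◅ y~j) u≁j′
    ...   | inj₂ (_ , refl) = contradiction y~j u≁j′

  -- Deleting an edge that is not a bridge keeps the graph connected, since a detour replaces the
  -- edge. Strict inclusion is well-founded, so this ends with only bridges left.
  spanningTree : ∀ T → (∀ u v → Conn g T u v) → ∃[ S ] Tree g S
  spanningTree T = prune T (⊂-wellFounded T)
    where
    prune : ∀ T → Acc _⊂_ T → (∀ u v → Conn g T u v) → ∃[ S ] Tree g S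
    prune T (acc rs) conn with allBridges? g T
    ... | yes br = T , conn , br
    ... | no ¬br with ¬∀⟶∃¬ _ _ (bridge? g T) ¬br
    ...   | e , ¬bridge = prune (T ∖ e) (rs (∖-⊆ , e , e∈T , λ e∈ → proj₂ (∈-∖⁻ e∈) refl)) conn′
      where
      e∈T : e ∈ₛ T
      e∈T = decidable-stable (e ∈? T) λ e∉T → ¬bridge λ e∈T → contradiction e∈T e∉T
      a~b : Conn g (T ∖ e) (proj₁ (g e)) (proj₂ (g e))
      a~b = decidable-stable (conn? g (T ∖ e) _ _) λ a≁b → ¬bridge λ _ → a≁b
      conn′ : ∀ u v → Conn g (T ∖ e) u v
      conn′ u v with Conn-split {T} {e} (inj₁ refl) (conn u v)
      ... | inj₁ u~v              = u~v
      ... | inj₂ (inj₁ (p , q))   = p ◅◅ a~b ◅◅ q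
      ... | inj₂ (inj₂ (p , q))   = p ◅◅ Conn-sym a~b ◅◅ q

-- Acyclic graphs are those in which every edge is a bridge

-- The list `vs` holds the interior vertices. The end `b` comes first in the uniqueness condition so
-- that an edge from `b` back to `a` closes the path to a cycle in the form of `IsCycle`.
SimplePath : ∀ {n} → Rel (Fin n) 0ℓ → Fin n → Fin n → Set
SimplePath R a b = ∃[ vs ] (Linked R (a ∷ vs ++ b ∷ []) × Unique (b ∷ a ∷ vs))

module _ {n} {R : Rel (Fin n) 0ℓ} where

  suffixFrom : ∀ {a b vs} → a ∈ vs → Linked R (vs ++ b ∷ []) → Unique (b ∷ vs) → SimplePath R a b
  suffixFrom (here refl) ls uniq = _ , ls , uniq
  suffixFrom {vs = _ ∷ _ ∷ _} (there a∈vs) (_ ∷ ls) ((_ ∷ b∉) ∷ _ ∷ uniq) =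
    suffixFrom a∈vs ls (b∉ ∷ uniq)

  -- Prefix the first step to a simple path from its far end; if `a` already lies on that path,
  -- restart at this occurrence, which cuts off the loop.
  simplePath : ∀ {a b} → a ≢ b → Star R a b → SimplePath R a b
  simplePath a≢b ε = contradiction refl a≢b
  simplePath {a} {b} a≢b (_◅_ {j = y} r y~b) with y ≟ b
  ... | yes refl = [] , r ∷ [-] , ((a≢b ∘ sym) ∷ []) ∷ [] ∷ []
  ... | no y≢b with simplePath y≢b y~b
  ...   | vs , ls , b∉ ∷ uniq with Any.any? (a ≟_) (y ∷ vs)
  ...     | yes a∈ = suffixFrom a∈ ls (b∉ ∷ uniq)
  ...     | no a∉  =
    y ∷ vs , r ∷ ls ,
    ((a≢b ∘ sym) ∷ b∉) ∷ All.tabulate (λ { x∈ refl → a∉ x∈ }) ∷ uniq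

module _ {n m} {g : Fin m → Fin n × Fin n}
  (loopless : ∀ {e u v} → Joins g e u v → u ≢ v)
  (noParallel : ∀ {e e′ u v} → Joins g e u v → Joins g e′ u v → e ≡ e′) where

  -- An edge that is not a bridge closes a simple path between its ends to a cycle. Conversely, the
  -- rest of a cycle connects the ends of its first edge without that edge.
  acyclic⇔allBridges : ∀ T → IsAcyclic (Adj g T) ⇔ AllBridges g T
  acyclic⇔allBridges T = mk⇔ to from
    where
    to : IsAcyclic (Adj g T) → AllBridges g T
    to acyclic e e∈T a~b with simplePath (loopless {e} (inj₁ refl)) a~b
    -- A path without interior vertices would be an edge parallel to `e`, so the cycle has at least
    -- three vertices.
    ... | [] , (f , f∈ , ab) ∷ [-] , _ = proj₂ (∈-∖⁻ f∈) (noParallel ab (inj₁ refl))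
    ... | v ∷ vs , ls , uniq =
      acyclic _ (_ ∷ v ∷ vs) ((e , e∈T , inj₂ refl) ∷ Linked-map ls , uniq , s≤s (s≤s z≤n))
      where
      Linked-map : ∀ {xs} → Linked (Adj g (T ∖ e)) xs → Linked (Adj g T) xs
      Linked-map = Linked.map λ { (f , f∈ , xy) → f , ∖-⊆ f∈ , xy }
    from : AllBridges g T → IsAcyclic (Adj g T)
    from br a (b ∷ []) (_ , _ , s≤s ())
    from br a (b ∷ c ∷ vs) ((e , e∈T , ab) ∷ bc ∷ ls , (a≢b ∷ a≢c ∷ a∉) ∷ (b≢c ∷ b∉) ∷ _ , _) =
      bridge br e∈T ab (Conn-sym (first bc ◅ rest c vs ls (a≢c ∷ a∉) (b≢c ∷ b∉)))
      where
      first : Adj g T b c → Adj g (T ∖ e) b c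
      first (f , f∈T , bc) = f , ∈-∖⁺ f≢e f∈T , bc
        where
        f≢e : f ≢ e
        f≢e refl with Joins-ends {g = g} ab bc
        ... | inj₁ (a≡b , _) = a≢b a≡b
        ... | inj₂ (a≡c , _) = a≢c a≡c
      -- From `c` on, every edge of the cycle starts at a vertex other than `a` and `b`, so it is
      -- not `e`.
      step : ∀ {x y} → a ≢ x → b ≢ x → Adj g T x y → Adj g (T ∖ e) x y
      step a≢x b≢x (f , f∈T , xy) = f , ∈-∖⁺ f≢e f∈T , xy
        where
        f≢e : f ≢ e
        f≢e refl with Joins-ends {g = g} ab xy
        ... | inj₁ (a≡x , _) = a≢x a≡x
        ... | inj₂ (_ , b≡x) = b≢x b≡x
      rest : ∀ x xs → Linked (Adj g T) (x ∷ xs ++ a ∷ []) → All (a ≢_) (x ∷ xs) →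
             All (b ≢_) (x ∷ xs) → Conn g (T ∖ e) x a
      rest x []       (xa ∷ [-]) (a≢x ∷ _)  (b≢x ∷ _)  = step a≢x b≢x xa ◅ ε
      rest x (y ∷ xs) (xy ∷ ls)  (a≢x ∷ a∉) (b≢x ∷ b∉) =
        step a≢x b≢x xy ◅ rest y xs ls a∉ b∉

-- Sums over vertices and over edge sets

⟦_⟧ : {P : Set} → Dec P → ℚ
⟦ P? ⟧ = if does P? then 1ℚ else 0ℚ

module _ {P : Set} where

  ⟦⟧-yes : (P? : Dec P) → P → ⟦ P? ⟧ ≡ 1ℚ
  ⟦⟧-yes (yes _) _ = refl
  ⟦⟧-yes (no ¬p) p = contradiction p ¬p

  ⟦⟧-no : (P? : Dec P) → ¬ P → ⟦ P? ⟧ ≡ 0ℚ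
  ⟦⟧-no (yes p) ¬p = contradiction p ¬p
  ⟦⟧-no (no _)  _  = refl

⟦⟧-cong : {P Q : Set} (P? : Dec P) (Q? : Dec Q) → P ⇔ Q → ⟦ P? ⟧ ≡ ⟦ Q? ⟧
⟦⟧-cong (yes p) Q? P⇔Q = sym (⟦⟧-yes Q? (Equivalence.to P⇔Q p))
⟦⟧-cong (no ¬p) Q? P⇔Q = sym (⟦⟧-no Q? (¬p ∘ Equivalence.from P⇔Q))

sum-zero : ∀ {n} {t : Fin n → ℚ} → (∀ i → t i ≡ 0ℚ) → sum t ≡ 0ℚ
sum-zero {n} t≡0 = trans (sum-cong-≗ t≡0) (sum-replicate-zero n)

sum-δ : ∀ {n} (i : Fin n) → sum (δ i) ≡ 1ℚ
sum-δ {suc n} zero    = trans (cong (1ℚ +_) (sum-zero {n} λ _ → refl)) refl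
sum-δ {suc n} (suc i) = trans (+-identityˡ (sum (δ i))) (sum-δ i)

sum-⟦∃!⟧ : ∀ {n} {P : Fin n → Set} (P? : ∀ i → Dec (P i)) →
  ∃[ i ] P i → (∀ {i j} → P i → P j → i ≡ j) → sum (λ i → ⟦ P? i ⟧) ≡ 1ℚ
sum-⟦∃!⟧ P? (i , p) unique = trans
  (sum-cong-≗ λ j → ⟦⟧-cong (P? j) (i ≟ j) (mk⇔ (unique p) λ { refl → p }))
  (sum-δ i)

sumₛ : ∀ {m} → (Subset m → ℚ) → ℚ
sumₛ {zero}  h = h []
sumₛ {suc m} h = sumₛ (h ∘ (outside ∷_)) + sumₛ (h ∘ (inside ∷_))

sumₛ-cong : ∀ {m} {h k : Subset m → ℚ} → (∀ T → h T ≡ k T) → sumₛ h ≡ sumₛ k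
sumₛ-cong {zero}  h≗k = h≗k []
sumₛ-cong {suc m} h≗k = cong₂ _+_ (sumₛ-cong (h≗k ∘ (outside ∷_))) (sumₛ-cong (h≗k ∘ (inside ∷_)))

sumₛ-zero : ∀ {m} {h : Subset m → ℚ} → (∀ T → h T ≡ 0ℚ) → sumₛ h ≡ 0ℚ
sumₛ-zero {zero}  h≡0 = h≡0 []
sumₛ-zero {suc m} h≡0 =
  cong₂ _+_ (sumₛ-zero (h≡0 ∘ (outside ∷_))) (sumₛ-zero (h≡0 ∘ (inside ∷_)))

+-interchange : ∀ a b c d → (a + b) + (c + d) ≡ (a + c) + (b + d)
+-interchange = solve 4 (λ a b c d → (a :+ b) :+ (c :+ d) := (a :+ c) :+ (b :+ d)) refl

sumₛ-distrib-+ : ∀ {m} (h k : Subset m → ℚ) → sumₛ (λ T → h T + k T) ≡ sumₛ h + sumₛ k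
sumₛ-distrib-+ {zero}  h k = refl
sumₛ-distrib-+ {suc m} h k =
  trans (cong₂ _+_ (sumₛ-distrib-+ (h ∘ (outside ∷_)) _) (sumₛ-distrib-+ (h ∘ (inside ∷_)) _))
        (+-interchange (sumₛ (h ∘ (outside ∷_))) (sumₛ (k ∘ (outside ∷_)))
                       (sumₛ (h ∘ (inside ∷_))) (sumₛ (k ∘ (inside ∷_))))

sum-sumₛ-comm : ∀ {n m} (h : Fin n → Subset m → ℚ) →
  sum (λ i → sumₛ (h i)) ≡ sumₛ λ T → sum λ i → h i T
sum-sumₛ-comm {m = zero}  h = refl
sum-sumₛ-comm {m = suc m} h =
  trans (∑-distrib-+ (λ i → sumₛ (h i ∘ (outside ∷_))) _)
        (cong₂ _+_ (sum-sumₛ-comm λ i → h i ∘ (outside ∷_)) (sum-sumₛ-comm λ i → h i ∘ (inside ∷_)))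

sumₛ-single : ∀ {m} {h : Subset m → ℚ} S → (∀ T → T ≢ S → h T ≡ 0ℚ) → sumₛ h ≡ h S
sumₛ-single []            h≡0 = refl
sumₛ-single {h = h} (outside ∷ S) h≡0 =
  trans (cong₂ _+_ (sumₛ-single S λ T T≢S → h≡0 (outside ∷ T) λ { refl → T≢S refl })
                   (sumₛ-zero λ T → h≡0 (inside ∷ T) λ ()))
        (+-identityʳ (h (outside ∷ S)))
sumₛ-single {h = h} (inside ∷ S) h≡0 =
  trans (cong₂ _+_ (sumₛ-zero λ T → h≡0 (outside ∷ T) λ ())
                   (sumₛ-single S λ T T≢S → h≡0 (inside ∷ T) λ { refl → T≢S refl }))
        (+-identityˡ (h (inside ∷ S)))

-- Deleting `e` is a bijection from the sets that contain `e` to those that do not.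
sumₛ-remove : ∀ {m} (e : Fin m) (h : Subset m → ℚ) →
  sumₛ (λ T → if does (e ∈? T) then h (T ∖ e) else 0ℚ) ≡
  sumₛ (λ T → if does (e ∈? T) then 0ℚ else h T)
sumₛ-remove {suc m} zero h = begin
  sumₛ {m} (λ _ → 0ℚ) + sumₛ (h ∘ (outside ∷_)) ≡⟨ +-comm (sumₛ {m} λ _ → 0ℚ) (sumₛ (h ∘ (outside ∷_))) ⟩
  sumₛ (h ∘ (outside ∷_)) + sumₛ {m} (λ _ → 0ℚ) ∎
  where open ≡-Reasoning
sumₛ-remove (suc e) h =
  cong₂ _+_ (sumₛ-remove e (h ∘ (outside ∷_))) (sumₛ-remove e (h ∘ (inside ∷_)))

_≟ₛ_ : ∀ {m} → DecidableEquality (Subset m)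
_≟ₛ_ = Vec-≡-dec Bool._≟_

-- Induction on the list: the indicator of `P` is that of the head plus that of membership in the
-- tail, and the latter membership takes the place of `P`.
count-list : ∀ {m} {P : Subset m → Set} (P? : ∀ T → Dec (P T)) {xs} → Unique xs →
  (∀ T → T ∈ xs ⇔ P T) → sumₛ (λ T → ⟦ P? T ⟧) ≡ length xs · 1ℚ
count-list P? [] ∈⇔P =
  sumₛ-zero λ T → ⟦⟧-no (P? T) λ p → contradiction (Equivalence.from (∈⇔P T) p) λ ()
count-list P? {x ∷ xs} (x∉xs ∷ unique) ∈⇔P = begin
  sumₛ (λ T → ⟦ P? T ⟧)                                 ≡⟨ sumₛ-cong split ⟩
  sumₛ (λ T → ⟦ T ≟ₛ x ⟧ + ⟦ T ∈xs? ⟧)                  ≡⟨ sumₛ-distrib-+ (λ T → ⟦ T ≟ₛ x ⟧) _ ⟩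
  sumₛ (λ T → ⟦ T ≟ₛ x ⟧) + sumₛ (λ T → ⟦ T ∈xs? ⟧)     ≡⟨ cong₂ _+_ single rest ⟩
  1ℚ + length xs · 1ℚ                                   ∎
  where
  open ≡-Reasoning
  _∈xs? : ∀ T → Dec (T ∈ xs)
  T ∈xs? = DecMembership._∈?_ _≟ₛ_ T xs
  split : ∀ T → ⟦ P? T ⟧ ≡ ⟦ T ≟ₛ x ⟧ + ⟦ T ∈xs? ⟧
  split T with T ≟ₛ x | T ∈xs?
  ... | yes refl | yes x∈xs = contradiction refl (All.lookup x∉xs x∈xs)
  ... | yes refl | no _     = ⟦⟧-yes (P? T) (Equivalence.to (∈⇔P T) (here refl))
  ... | no _     | yes T∈xs = ⟦⟧-yes (P? T) (Equivalence.to (∈⇔P T) (there T∈xs))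
  ... | no T≢x   | no T∉xs  = ⟦⟧-no (P? T) λ p → ∉ (Equivalence.from (∈⇔P T) p)
    where
    ∉ : ¬ T ∈ x ∷ xs
    ∉ (here T≡x)   = T≢x T≡x
    ∉ (there T∈xs) = T∉xs T∈xs
  single : sumₛ (λ T → ⟦ T ≟ₛ x ⟧) ≡ 1ℚ
  single = trans (sumₛ-single x λ T T≢x → ⟦⟧-no (T ≟ₛ x) T≢x) (⟦⟧-yes (x ≟ₛ x) refl)
  rest : sumₛ (λ T → ⟦ T ∈xs? ⟧) ≡ length xs · 1ℚ
  rest = count-list _∈xs? unique λ T → mk⇔ (λ p → p) (λ p → p)

count-HasCardinality : ∀ {m k} {P : Subset m → Set} (P? : ∀ T → Dec (P T)) →
  HasCardinality P k → sumₛ (λ T → ⟦ P? T ⟧) ≡ k · 1ℚ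
count-HasCardinality P? (xs , unique , ∈⇔P , refl) = count-list P? unique ∈⇔P

-- Counting trees and two-component forests

module _ {n m} (g : Fin m → Fin n × Fin n) where

  treeCount : ℚ
  treeCount = sumₛ λ T → ⟦ tree? g T ⟧

  separatingForests : Fin n → Fin n → ℚ
  separatingForests u j = sumₛ λ T → ⟦ separates? g T u j ⟧

  separatingForests₃ : Fin n → Fin n → Fin n → ℚ
  separatingForests₃ u w j = sumₛ λ T → ⟦ separates? g T u j ×-dec conn? g T w j ⟧

  joins? : ∀ e u w → Dec (Joins g e u w)
  joins? e u w = ×-≡-dec _≟_ _≟_ (g e) (u , w) ⊎-dec ×-≡-dec _≟_ _≟_ (g e) (w , u)

  firstEdge? : ∀ T u j w → Dec (∃[ e ] FirstEdge {g = g} T u j w e)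
  firstEdge? T u j w = any? λ e → joins? e u w ×-dec (e ∈? T) ×-dec conn? g (T ∖ e) w j

module _ {n m} {g : Fin m → Fin n × Fin n} where

  private
    F  = separatingForests g
    F₃ = separatingForests₃ g

  separates-sym : ∀ {T u j} → Separates g T u j → Separates g T j u
  separates-sym (br , side , u≁j) = br , (λ v → swap (side v)) , u≁j ∘ Conn-sym

  separates-resp : ∀ {T u w j} → Conn g T u w → Separates g T u j → Separates g T w j
  separates-resp {T} {u} {w} {j} u~w (br , side , u≁j) = br , side′ , λ w~j → u≁j (u~w ◅◅ w~j)
    where
    side′ : ∀ v → Conn g T v w ⊎ Conn g T v j
    side′ v = map₁ (_◅◅ u~w) (side v)

  separatingForests-sym : ∀ u j → F u j ≡ F j u
  separatingForests-sym u j = sumₛ-cong λ T →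
    ⟦⟧-cong (separates? g T u j) (separates? g T j u) (mk⇔ separates-sym separates-sym)

  separatingForests-refl : ∀ u → F u u ≡ 0ℚ
  separatingForests-refl u =
    sumₛ-zero λ T → ⟦⟧-no (separates? g T u u) λ (_ , _ , u≁u) → u≁u ε

  separatingForests₃-refl : ∀ u w → F₃ u w u ≡ 0ℚ
  separatingForests₃-refl u w =
    sumₛ-zero λ T → ⟦⟧-no (separates? g T u u ×-dec conn? g T w u)
      λ ((_ , _ , u≁u) , _) → u≁u ε

  -- In a forest with two components, u is alone among u, w, j (twice the first
  -- summand on the right), or w or j is.
  separatingForests-triangle : ∀ u w j → F u j + F u w ≡ (F₃ u w j + F₃ u w j) + F w j
  separatingForests-triangle u w j = begin
    F u j + F u w                 ≡⟨ sumₛ-distrib-+ (s u j) (s u w) ⟨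
    sumₛ (λ T → s u j T + s u w T) ≡⟨ sumₛ-cong pointwise ⟩
    sumₛ (λ T → (s₃ T + s₃ T) + s w j T) ≡⟨ sumₛ-distrib-+ (λ T → s₃ T + s₃ T) (s w j) ⟩
    sumₛ (λ T → s₃ T + s₃ T) + F w j     ≡⟨ cong (_+ F w j) (sumₛ-distrib-+ s₃ s₃) ⟩
    (F₃ u w j + F₃ u w j) + F w j ∎
    where
    open ≡-Reasoning
    s : Fin n → Fin n → Subset m → ℚ
    s a b T = ⟦ separates? g T a b ⟧
    s₃ : Subset m → ℚ
    s₃ T = ⟦ separates? g T u j ×-dec conn? g T w j ⟧
    pointwise : ∀ T → s u j T + s u w T ≡ (s₃ T + s₃ T) + s w j T
    pointwise T with separates? g T u j | conn? g T w j
    ... | yes uj | yes w~j =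
      trans (cong (1ℚ +_) uw≡1) (sym (cong (1ℚ + 1ℚ +_) wj≡0))
      where
      uw≡1 = ⟦⟧-yes (separates? g T u w) (separates-sym (separates-resp (Conn-sym w~j) (separates-sym uj)))
      wj≡0 = ⟦⟧-no (separates? g T w j) λ (_ , _ , w≁j) → w≁j w~j
    ... | yes uj@(_ , side , _) | no w≁j =
      trans (cong (1ℚ +_) uw≡0) (sym (cong (0ℚ + 0ℚ +_) wj≡1))
      where
      u~w : Conn g T u w
      u~w with side w
      ... | inj₁ w~u = Conn-sym w~u
      ... | inj₂ w~j = contradiction w~j w≁j
      uw≡0 = ⟦⟧-no (separates? g T u w) λ (_ , _ , u≁w) → u≁w u~w
      wj≡1 = ⟦⟧-yes (separates? g T w j) (separates-resp u~w uj)
    ... | no ¬uj | _ with separates? g T u w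
    ...   | yes uw@(_ , side , _) = sym (cong (0ℚ + 0ℚ +_) wj≡1)
      where
      u~j : Conn g T u j
      u~j with side j
      ... | inj₁ j~u = Conn-sym j~u
      ... | inj₂ j~w = contradiction (separates-sym (separates-resp (Conn-sym j~w) (separates-sym uw))) ¬uj
      wj≡1 = ⟦⟧-yes (separates? g T w j) (separates-sym (separates-resp u~j uw))
    ...   | no ¬uw = sym (cong (0ℚ + 0ℚ +_) wj≡0)
      where
      ¬wj : ¬ Separates g T w j
      ¬wj wj@(_ , side , _) with side u
      ... | inj₁ u~w = ¬uj (separates-resp (Conn-sym u~w) wj)
      ... | inj₂ u~j = ¬uw (separates-resp (Conn-sym u~j) (separates-sym wj))
      wj≡0 = ⟦⟧-no (separates? g T w j) ¬wj

  -- A forest counted on the left cannot contain `e`, which would join `u` to `w` and so to `j`.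
  -- Adding `e` gives a tree whose path from `u` to `j` begins with `e`, and deleting `e` is the
  -- inverse.
  separatingForests₃-edge : ∀ {e u w} j → Joins g e u w →
    F₃ u w j ≡ sumₛ λ T → ⟦ tree? g T ×-dec (e ∈? T) ×-dec conn? g (T ∖ e) w j ⟧
  separatingForests₃-edge {e} {u} {w} j uw = begin
    F₃ u w j                                               ≡⟨ sumₛ-cong without ⟩
    sumₛ (λ T → if does (e ∈? T) then 0ℚ else s₃ T)        ≡⟨ sumₛ-remove e s₃ ⟨
    sumₛ (λ T → if does (e ∈? T) then s₃ (T ∖ e) else 0ℚ)  ≡⟨ sumₛ-cong add ⟩
    sumₛ (λ T → ⟦ tree? g T ×-dec (e ∈? T) ×-dec conn? g (T ∖ e) w j ⟧) ∎
    where
    open ≡-Reasoning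
    s₃? : ∀ T → Dec (Separates g T u j × Conn g T w j)
    s₃? T = separates? g T u j ×-dec conn? g T w j
    s₃ : Subset m → ℚ
    s₃ T = ⟦ s₃? T ⟧
    without : ∀ T → s₃ T ≡ (if does (e ∈? T) then 0ℚ else s₃ T)
    without T with e ∈? T
    ... | yes e∈T = ⟦⟧-no (s₃? T) λ (uj , w~j) → separates⇒∉ uw uj w~j e∈T
    ... | no _    = refl
    add : ∀ T → (if does (e ∈? T) then s₃ (T ∖ e) else 0ℚ) ≡
                ⟦ tree? g T ×-dec (e ∈? T) ×-dec conn? g (T ∖ e) w j ⟧
    add T with e ∈? T
    ... | no e∉T = sym (⟦⟧-no (tree? g T ×-dec no e∉T ×-dec conn? g (T ∖ e) w j)
                              λ (_ , e∈T , _) → e∉T e∈T)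
    ... | yes e∈T = ⟦⟧-cong (s₃? (T ∖ e)) (tree? g T ×-dec yes e∈T ×-dec conn? g (T ∖ e) w j)
      (mk⇔ (λ (uj , w~j) → Equivalence.from (tree∖edge uw e∈T w~j) uj , e∈T , w~j)
           (λ (tree , _ , w~j) → Equivalence.to (tree∖edge uw e∈T w~j) tree , w~j))

  -- The case `j` equal to `w` of `separatingForests₃-edge`, where the connectivity condition holds
  -- by the empty walk.
  separatingForests-edge : ∀ {e u w} → Joins g e u w →
    F u w ≡ sumₛ λ T → ⟦ tree? g T ×-dec (e ∈? T) ⟧
  separatingForests-edge {e} {u} {w} uw = begin
    F u w    ≡⟨ sumₛ-cong (λ T → ⟦⟧-cong (separates? g T u w) (separates? g T u w ×-dec conn? g T w w)
                                   (mk⇔ (_, ε) proj₁)) ⟩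
    F₃ u w w ≡⟨ separatingForests₃-edge w uw ⟩
    sumₛ (λ T → ⟦ tree? g T ×-dec (e ∈? T) ×-dec conn? g (T ∖ e) w w ⟧)
             ≡⟨ sumₛ-cong (λ T → ⟦⟧-cong (tree? g T ×-dec (e ∈? T) ×-dec conn? g (T ∖ e) w w)
                                         (tree? g T ×-dec (e ∈? T))
                                         (mk⇔ (λ (t , e∈ , _) → t , e∈) (λ (t , e∈) → t , e∈ , ε))) ⟩
    sumₛ (λ T → ⟦ tree? g T ×-dec (e ∈? T) ⟧) ∎
    where open ≡-Reasoning

  module _ {_~_ : Fin n → Fin n → Set} (_~?_ : ∀ u w → Dec (u ~ w))
    (joins⇒~ : ∀ {e u w} → Joins g e u w → u ~ w)
    (~⇒joins : ∀ {u w} → u ~ w → ∃[ e ] Joins g e u w)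
    (noParallel : ∀ {e e′ u v} → Joins g e u v → Joins g e′ u v → e ≡ e′) where

    -- A spanning tree is cut into a forest by deleting the first edge of its path
    -- from u to j.
    sum-separatingForests₃ : ∀ {u j} → u ≢ j →
      sum (λ w → if does (u ~? w) then F₃ u w j else 0ℚ) ≡ treeCount g
    sum-separatingForests₃ {u} {j} u≢j = begin
      sum (λ w → if does (u ~? w) then F₃ u w j else 0ℚ) ≡⟨ sum-cong-≗ neighbour ⟩
      sum (λ w → sumₛ λ T → ⟦ first? T w ⟧)              ≡⟨ sum-sumₛ-comm (λ w T → ⟦ first? T w ⟧) ⟩
      sumₛ (λ T → sum λ w → ⟦ first? T w ⟧)              ≡⟨ sumₛ-cong unique ⟩
      treeCount g                                        ∎
      where
      open ≡-Reasoning
      first? : ∀ T w → Dec (Tree g T × ∃[ e ] FirstEdge {g = g} T u j w e)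
      first? T w = tree? g T ×-dec firstEdge? g T u j w
      -- An edge from `u` to `w` exists only for neighbours `w` and is then unique, so fixing it or
      -- quantifying over it gives the same count.
      neighbour : ∀ w → (if does (u ~? w) then F₃ u w j else 0ℚ) ≡ sumₛ λ T → ⟦ first? T w ⟧
      neighbour w with u ~? w
      ... | no u≁w = sym (sumₛ-zero λ T → ⟦⟧-no (first? T w) λ (_ , _ , uw , _) → u≁w (joins⇒~ uw))
      ... | yes u~w with ~⇒joins u~w
      ...   | e , uw = trans (separatingForests₃-edge j uw) (sumₛ-cong λ T →
        ⟦⟧-cong (tree? g T ×-dec (e ∈? T) ×-dec conn? g (T ∖ e) w j) (first? T w)
          (mk⇔ (λ (tree , e∈T , w~j) → tree , e , uw , e∈T , w~j)
               (λ { (tree , e′ , uw′ , rest) → tree , coerce (noParallel uw′ uw) rest })))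
        where
        coerce : ∀ {T e′} → e′ ≡ e → e′ ∈ₛ T × Conn g (T ∖ e′) w j → e ∈ₛ T × Conn g (T ∖ e) w j
        coerce refl x = x
      -- Each tree is counted once, because its path from `u` to `j` has exactly one first edge.
      unique : ∀ T → sum (λ w → ⟦ first? T w ⟧) ≡ ⟦ tree? g T ⟧
      unique T with tree? g T
      ... | no _ = sum-zero {n} λ _ → refl
      ... | yes (conn , br) = sum-⟦∃!⟧ (firstEdge? g T u j) (firstEdge-exists u≢j (conn u j))
        λ (_ , first) (_ , first′) → firstEdge-unique br first first′

-- Positivity and cancellation in ℚ

+-≡0⇒≡0 : ∀ {a b} → 0ℚ ≤ a → 0ℚ ≤ b → a + b ≡ 0ℚ → a ≡ 0ℚ × b ≡ 0ℚ
+-≡0⇒≡0 {a} {b} 0≤a 0≤b a+b≡0 = ≤-antisym a≤0 0≤a , ≤-antisym b≤0 0≤b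
  where
  a≤0 : a ≤ 0ℚ
  a≤0 = ≤-trans (≤-reflexive (sym (+-identityʳ a))) (≤-trans (+-monoʳ-≤ a 0≤b) (≤-reflexive a+b≡0))
  b≤0 : b ≤ 0ℚ
  b≤0 = ≤-trans (≤-reflexive (sym (+-identityˡ b))) (≤-trans (+-monoˡ-≤ b 0≤a) (≤-reflexive a+b≡0))

sum-nonNeg : ∀ {n} {t : Fin n → ℚ} → (∀ i → 0ℚ ≤ t i) → 0ℚ ≤ sum t
sum-nonNeg {zero}  0≤t = ≤-refl
sum-nonNeg {suc n} 0≤t = +-mono-≤ (0≤t zero) (sum-nonNeg (0≤t ∘ suc))

sum-≡0⇒≡0 : ∀ {n} {t : Fin n → ℚ} → (∀ i → 0ℚ ≤ t i) → sum t ≡ 0ℚ → ∀ i → t i ≡ 0ℚ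
sum-≡0⇒≡0 {suc n} {t} 0≤t eq i
  with +-≡0⇒≡0 {t zero} {sum (t ∘ suc)} (0≤t zero) (sum-nonNeg (0≤t ∘ suc)) eq
sum-≡0⇒≡0 {suc n} 0≤t eq zero    | t₀≡0 , _ = t₀≡0
sum-≡0⇒≡0 {suc n} 0≤t eq (suc i) | _ , eq′  = sum-≡0⇒≡0 (0≤t ∘ suc) eq′ i

sumₛ-nonNeg : ∀ {m} {h : Subset m → ℚ} → (∀ T → 0ℚ ≤ h T) → 0ℚ ≤ sumₛ h
sumₛ-nonNeg {zero}  0≤h = 0≤h _
sumₛ-nonNeg {suc m} 0≤h = +-mono-≤ (sumₛ-nonNeg λ T → 0≤h (outside ∷ T)) (sumₛ-nonNeg λ T → 0≤h (inside ∷ T))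

sumₛ-≡0⇒≡0 : ∀ {m} {h : Subset m → ℚ} → (∀ T → 0ℚ ≤ h T) → sumₛ h ≡ 0ℚ → ∀ T → h T ≡ 0ℚ
sumₛ-≡0⇒≡0 {zero} 0≤h eq [] = eq
sumₛ-≡0⇒≡0 {suc m} {h} 0≤h eq (s ∷ T)
  with +-≡0⇒≡0 (sumₛ-nonNeg λ T → 0≤h (outside ∷ T)) (sumₛ-nonNeg λ T → 0≤h (inside ∷ T)) eq
sumₛ-≡0⇒≡0 {suc m} 0≤h eq (outside ∷ T) | eq₀ , _ = sumₛ-≡0⇒≡0 (λ T → 0≤h (outside ∷ T)) eq₀ T
sumₛ-≡0⇒≡0 {suc m} 0≤h eq (inside ∷ T)  | _ , eq₁ = sumₛ-≡0⇒≡0 (λ T → 0≤h (inside ∷ T)) eq₁ T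

⟦⟧-nonNeg : {P : Set} (P? : Dec P) → 0ℚ ≤ ⟦ P? ⟧
⟦⟧-nonNeg (yes _) = nonNegative⁻¹ 1ℚ
⟦⟧-nonNeg (no _)  = ≤-refl

-- The terms are nonnegative, so a vanishing sum would force the term of `T`, which is 1, to vanish.
treeCount≢0 : ∀ {n m} {g : Fin m → Fin n × Fin n} T → Tree g T → treeCount g ≢ 0ℚ
treeCount≢0 {g = g} T tree eq = contradiction
  (trans (sym (⟦⟧-yes (tree? g T) tree)) (sumₛ-≡0⇒≡0 (λ T → ⟦⟧-nonNeg (tree? g T)) eq T)) λ ()

·1-nonNeg : ∀ n → 0ℚ ≤ n · 1ℚ
·1-nonNeg zero    = ≤-refl
·1-nonNeg (suc n) = +-mono-≤ (nonNegative⁻¹ 1ℚ) (·1-nonNeg n)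

suc·1≢0 : ∀ n → suc n · 1ℚ ≢ 0ℚ
suc·1≢0 n eq = contradiction (proj₁ (+-≡0⇒≡0 (nonNegative⁻¹ 1ℚ) (·1-nonNeg n) eq)) λ ()

·1-injective : ∀ m n → m · 1ℚ ≡ n · 1ℚ → m ≡ n
·1-injective zero    zero    _  = refl
·1-injective zero    (suc n) eq = contradiction (sym eq) (suc·1≢0 n)
·1-injective (suc m) zero    eq = contradiction eq (suc·1≢0 m)
·1-injective (suc m) (suc n) eq = cong suc (·1-injective m n (∙-cancelˡ 1ℚ _ _ eq))

*-cancelˡ-≡ : ∀ {a x y} → a ≢ 0ℚ → a * x ≡ a * y → x ≡ y
*-cancelˡ-≡ {a} {x} {y} a≢0 ax≡ay = begin
  x              ≡⟨ undo x ⟨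
  1/ a * (a * x) ≡⟨ cong (1/ a *_) ax≡ay ⟩
  1/ a * (a * y) ≡⟨ undo y ⟩
  y              ∎
  where
  open ≡-Reasoning
  instance _ = ≢-nonZero a≢0
  undo : ∀ z → 1/ a * (a * z) ≡ z
  undo z = trans (sym (*-assoc (1/ a) a z)) (trans (cong (_* z) (*-inverseˡ a)) (*-identityˡ z))

-- Identities for finite sums and lists

sum-distrib-- : ∀ {n} (s t : Fin n → ℚ) → sum (λ i → s i - t i) ≡ sum s - sum t
sum-distrib-- {zero}  s t = refl
sum-distrib-- {suc n} s t = trans (cong (s zero - t zero +_) (sum-distrib-- (s ∘ suc) (t ∘ suc)))
  (solve 4 (λ a b c d → (a :- b) :+ (c :- d) := (a :+ c) :- (b :+ d)) refl
    (s zero) (t zero) (sum (s ∘ suc)) (sum (t ∘ suc)))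

sum-const : ∀ n c → sum {n} (λ _ → c) ≡ n · 1ℚ * c
sum-const n c = begin
  sum {n} (λ _ → c)      ≡⟨ sum-cong-≗ {n} (λ _ → *-identityˡ c) ⟨
  sum {n} (λ _ → 1ℚ * c) ≡⟨ *-distribʳ-sum {n} c (λ _ → 1ℚ) ⟨
  sum {n} (λ _ → 1ℚ) * c ≡⟨ cong (_* c) (sum-replicate n) ⟩
  n · 1ℚ * c             ∎
  where open ≡-Reasoning

-- A general `h` lets the induction shift indices; with `h` the identity this expresses a degree as
-- a sum of indicators.
length-filter-tabulate : ∀ {A : Set} {P : A → Set} (P? : ∀ x → Dec (P x)) {n} (h : Fin n → A) →
  length (filter P? (tabulate h)) · 1ℚ ≡ sum (λ i → ⟦ P? (h i) ⟧)
length-filter-tabulate P? {zero}  h = refl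
length-filter-tabulate P? {suc n} h with P? (h zero)
... | yes _ = cong (1ℚ +_) (length-filter-tabulate P? (h ∘ suc))
... | no _  = trans (length-filter-tabulate P? (h ∘ suc)) (sym (+-identityˡ _))

lookup-injective : {A : Set} {xs : List A} → Unique xs →
  ∀ i j → lookup xs i ≡ lookup xs j → i ≡ j
lookup-injective (_ ∷ _)    zero    zero    _  = refl
lookup-injective {xs = _ ∷ xs} (x∉ ∷ _) zero (suc j) eq =
  contradiction eq (All.lookup x∉ (∈-lookup {xs = xs} j))
lookup-injective {xs = _ ∷ xs} (x∉ ∷ _) (suc i) zero eq =
  contradiction (sym eq) (All.lookup x∉ (∈-lookup {xs = xs} i))
lookup-injective (_ ∷ uniq) (suc i) (suc j) eq = cong suc (lookup-injective uniq i j eq)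

-- The network

Fin-unique : ∀ {n} → n ≡ 1 → (u v : Fin n) → u ≡ v
Fin-unique refl zero zero = refl

module _ {n} (G : Graph n) where
  open Graph G

  endpoints : Edge G → Fin n × Fin n
  endpoints = lookup (edges G)

  edge? : ∀ ((u , v) : Fin n × Fin n) → Dec (u < v × u ~ v)
  edge? (u , v) = (u <? v) ×-dec (u ~? v)

  endpoints-ordered : ∀ e {u v} → endpoints e ≡ (u , v) → u < v × u ~ v
  endpoints-ordered e eq =
    subst (λ (u , v) → u < v × u ~ v) eq
      (proj₂ (∈-filter⁻ edge? {xs = cartesianProduct (allFin n) (allFin n)} (∈-lookup {xs = edges G} e)))

  joins⇒~ : ∀ {e u v} → Joins endpoints e u v → u ~ v
  joins⇒~ {e} (inj₁ eq) = proj₂ (endpoints-ordered e eq)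
  joins⇒~ {e} (inj₂ eq) = symm (proj₂ (endpoints-ordered e eq))

  joins-loopless : ∀ {e u v} → Joins endpoints e u v → u ≢ v
  joins-loopless {e} uv u≡v = irrefl u≡v (joins⇒~ {e} uv)

  <∧~⇒joins : ∀ {u v} → u < v → u ~ v → ∃[ e ] endpoints e ≡ (u , v)
  <∧~⇒joins {u} {v} u<v u~v = index uv∈ , sym (lookup-index uv∈)
    where uv∈ = ∈-filter⁺ edge? (∈-cartesianProduct⁺ (∈-allFin u) (∈-allFin v)) (u<v , u~v)

  ~⇒joins : ∀ {u v} → u ~ v → ∃[ e ] Joins endpoints e u v
  ~⇒joins {u} {v} u~v with <-cmp u v
  ... | tri< u<v _ _ = let e , eq = <∧~⇒joins u<v u~v in e , inj₁ eq
  ... | tri≈ _ u≡v _ = contradiction u~v (irrefl u≡v)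
  ... | tri> _ _ v<u = let e , eq = <∧~⇒joins v<u (symm u~v) in e , inj₂ eq

  -- Each edge is listed with its smaller end first, which excludes opposite orientations, and the
  -- list has no repetitions.
  joins-noParallel : ∀ {e e′ u v} → Joins endpoints e u v → Joins endpoints e′ u v → e ≡ e′
  joins-noParallel {e} {e′} {u} {v} = go
    where
    same : ∀ {p} → endpoints e ≡ p → endpoints e′ ≡ p → e ≡ e′
    same eq eq′ = lookup-injective
      (filter⁺ edge? (cartesianProduct⁺ (allFin⁺ n) (allFin⁺ n))) e e′ (trans eq (sym eq′))
    opposite : ∀ {u v} → endpoints e ≡ (u , v) → endpoints e′ ≡ (v , u) → e ≡ e′
    opposite eq eq′ = contradiction
      (proj₁ (endpoints-ordered e′ eq′)) (<-asym (proj₁ (endpoints-ordered e eq)))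
    go : Joins endpoints e u v → Joins endpoints e′ u v → e ≡ e′
    go (inj₁ eq) (inj₁ eq′) = same eq eq′
    go (inj₁ eq) (inj₂ eq′) = opposite eq eq′
    go (inj₂ eq) (inj₁ eq′) = opposite eq eq′
    go (inj₂ eq) (inj₂ eq′) = same eq eq′

  -- One form of linearity serves both uses: `c` is the normalising factor for the Kirchhoff
  -- potential, and 1 when two potentials are compared.
  outflow-scale : ∀ c (φ ψ : Fin n → ℚ) u →
    outflow G (λ v → c * (φ v - ψ v)) u ≡ c * (outflow G φ u - outflow G ψ u)
  outflow-scale c φ ψ u = begin
    outflow G (λ v → c * (φ v - ψ v)) u         ≡⟨ sum-cong-≗ term ⟩
    sum (λ w → c * (d φ w - d ψ w))             ≡⟨ *-distribˡ-sum c (λ w → d φ w - d ψ w) ⟨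
    c * sum (λ w → d φ w - d ψ w)               ≡⟨ cong (c *_) (sum-distrib-- (d φ) (d ψ)) ⟩
    c * (outflow G φ u - outflow G ψ u)         ∎
    where
    open ≡-Reasoning
    d : (Fin n → ℚ) → Fin n → ℚ
    d φ w = if does (u ~? w) then φ u - φ w else 0ℚ
    term : ∀ w → d (λ v → c * (φ v - ψ v)) w ≡ c * (d φ w - d ψ w)
    term w with u ~? w
    ... | yes _ = solve 5 (λ c a b x y → c :* (a :- b) :- c :* (x :- y) := c :* ((a :- x) :- (b :- y)))
                    refl c (φ u) (ψ u) (φ w) (ψ w)
    ... | no _  = sym (*-zeroʳ c)

  outflow-∑ : ∀ {m} (h : Fin m → Fin n → ℚ) u →
    outflow G (λ v → sum λ j → h j v) u ≡ sum (λ j → outflow G (h j) u)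
  outflow-∑ {m} h u = trans (sum-cong-≗ term)
    (∑-comm λ w j → if does (u ~? w) then h j u - h j w else 0ℚ)
    where
    term : ∀ w → (if does (u ~? w) then (sum λ j → h j u) - (sum λ j → h j w) else 0ℚ) ≡
                 sum λ j → if does (u ~? w) then h j u - h j w else 0ℚ
    term w with u ~? w
    ... | yes _ = sym (sum-distrib-- (λ j → h j u) (λ j → h j w))
    ... | no _  = sym (sum-zero {m} λ _ → refl)

  constant⇒harmonic : ∀ {φ} → (∀ u v → φ u ≡ φ v) → ∀ u → outflow G φ u ≡ 0ℚ
  constant⇒harmonic {φ} constant u = sum-zero {n} term
    where
    term : ∀ w → (if does (u ~? w) then φ u - φ w else 0ℚ) ≡ 0ℚ
    term w with u ~? w
    ... | yes _ = trans (cong (_- φ w) (constant u w)) (+-inverseʳ (φ w))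
    ... | no _  = refl

  -- The current along an edge leaves one end and enters the other; summed over all ordered pairs,
  -- the two contributions `a u w` and `a w u` cancel.
  sum-outflow : ∀ φ → sum (outflow G φ) ≡ 0ℚ
  sum-outflow φ = begin
    sum (outflow G φ)                             ≡⟨ sum-cong-≗ (λ u → trans (sum-cong-≗ (term u)) (sum-distrib-- (a u) λ w → a w u)) ⟩
    sum (λ u → sum (a u) - sum (λ w → a w u))     ≡⟨ sum-distrib-- (λ u → sum (a u)) (λ u → sum λ w → a w u) ⟩
    sum (λ u → sum (a u)) - sum (λ u → sum λ w → a w u) ≡⟨ cong (λ x → sum (λ u → sum (a u)) - x) (∑-comm a) ⟨
    sum (λ u → sum (a u)) - sum (λ u → sum (a u)) ≡⟨ +-inverseʳ (sum λ u → sum (a u)) ⟩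
    0ℚ                                            ∎
    where
    open ≡-Reasoning
    a : Fin n → Fin n → ℚ
    a u w = if does (u ~? w) then φ u else 0ℚ
    term : ∀ u w → (if does (u ~? w) then φ u - φ w else 0ℚ) ≡ a u w - a w u
    term u w with u ~? w | w ~? u
    ... | yes _   | yes _   = refl
    ... | yes u~w | no w≁u  = contradiction (symm u~w) w≁u
    ... | no u≁w  | yes w~u = contradiction (symm w~u) u≁w
    ... | no _    | no _    = refl

  -- The maximum principle: the neighbours of a maximum are maxima.
  harmonic⇒constant : Connected G → ∀ φ → (∀ u → outflow G φ u ≡ 0ℚ) → ∀ u v → φ u ≡ φ v
  harmonic⇒constant conn φ harmonic u v = trans (sym (along (walk top u))) (along (walk top v))
    where
    open IsConnected conn
    open Extrema (DecTotalOrder.totalOrder ≤-decTotalOrder) using (argmax; f[xs]≤f[argmax])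
    top : Fin n
    top = argmax φ u (allFin n)
    φ≤top : ∀ v → φ v ≤ φ top
    φ≤top v = All.lookup (f[xs]≤f[argmax] {f = φ} u (allFin n)) (∈-allFin v)
    drop : Fin n → Fin n → ℚ
    drop x w = if does (x ~? w) then φ x - φ w else 0ℚ
    step : ∀ {x y} → φ top ≡ φ x → x ~ y → φ top ≡ φ y
    -- All drops from a maximum are nonnegative, and they sum to the outflow 0, so each of them
    -- vanishes.
    step {x} {y} top≡x x~y = trans top≡x (x∙y⁻¹≈ε⇒x≈y (φ x) (φ y) (φx-φy≡0 (sum-≡0⇒≡0 0≤drop (harmonic x) y)))
      where
      0≤drop : ∀ w → 0ℚ ≤ drop x w
      0≤drop w with x ~? w
      ... | yes _ = ≤-trans (≤-reflexive (sym (+-inverseʳ (φ w))))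
                            (+-monoˡ-≤ (- φ w) (≤-trans (φ≤top w) (≤-reflexive top≡x)))
      ... | no _  = ≤-refl
      φx-φy≡0 : drop x y ≡ 0ℚ → φ x - φ y ≡ 0ℚ
      φx-φy≡0 eq with x ~? y
      ... | yes _  = eq
      ... | no x≁y = contradiction x~y x≁y
    along′ : ∀ {x y} → φ top ≡ φ x → Star _~_ x y → φ top ≡ φ y
    along′ eq ε          = eq
    along′ eq (x~z ◅ zs) = along′ (step eq x~z) zs
    along : ∀ {y} → Star _~_ top y → φ top ≡ φ y
    along = along′ refl

-- Resistances and row sums

module _ {n} (G : Graph n) where
  open Graph G

  isSpanningTree⇔tree : Connected G → ∀ T → Tree (endpoints G) T ⇔ IsSpanningTree G T
  isSpanningTree⇔tree conn T = mk⇔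
    (λ (walk , br) → record { nonEmpty = IsConnected.nonEmpty conn ; walk = walk } , from br)
    (λ (connected , acyclic) → IsConnected.walk connected , to acyclic)
    where open Equivalence (acyclic⇔allBridges (λ {e} → joins-loopless G {e}) (joins-noParallel G) T)

  module _ (conn : Connected G) (k : ℕ)
    (treesThrough : ∀ e → HasCardinality (λ T → IsSpanningTree G T × e ∈ₛ T) k) where

    private
      τ κ N : ℚ
      τ = treeCount (endpoints G)
      κ = k · 1ℚ
      N = n · 1ℚ

      f : Fin n → Fin n → ℚ
      f = separatingForests (endpoints G)

      f₃ : Fin n → Fin n → Fin n → ℚ
      f₃ = separatingForests₃ (endpoints G)

      D ρ : Fin n → ℚ
      D u = degree G u · 1ℚ
      ρ v = sum λ j → f v j

    τ≢0 : τ ≢ 0ℚ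
    τ≢0 = let T , tree = spanningTree ⊤ connected in treeCount≢0 T tree
      where
      connected : ∀ u v → Conn (endpoints G) ⊤ u v
      connected u v = Star.map (λ u~v → let e , uv = ~⇒joins G u~v in e , ∈⊤ , uv)
                               (IsConnected.walk conn u v)

    2τ≢0 : τ + τ ≢ 0ℚ
    2τ≢0 2τ≡0 = τ≢0 (*-cancelˡ-≡ {1ℚ + 1ℚ} (λ ()) (begin
      (1ℚ + 1ℚ) * τ ≡⟨ solve 1 (λ t → (con 1ℚ :+ con 1ℚ) :* t := t :+ t) refl τ ⟩
      τ + τ         ≡⟨ 2τ≡0 ⟩
      0ℚ            ≡⟨ *-zeroʳ (1ℚ + 1ℚ) ⟨
      (1ℚ + 1ℚ) * 0ℚ ∎))
      where
      open ≡-Reasoning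

    -- This is where equiarboreality enters: for adjacent vertices the forests correspond to the
    -- spanning trees through their edge, and each edge lies in `k` of these.
    separatingForests-adjacent : ∀ {u w} → u ~ w → f u w ≡ κ
    separatingForests-adjacent {u} {w} u~w with ~⇒joins G u~w
    ... | e , uw = trans (separatingForests-edge {g = endpoints G} uw) (count-HasCardinality through? (treesThrough e))
      where
      through? : ∀ T → Dec (IsSpanningTree G T × e ∈ₛ T)
      through? T = Dec.map (isSpanningTree⇔tree conn T) (tree? (endpoints G) T) ×-dec (e ∈? T)

    -- Adding `κ` for each neighbour `w` turns the drop into twice `f₃ u w j`, by the triangle
    -- relation. Over all neighbours, `f₃ u w j` sums to `τ` if `u` differs from `j`, and to 0
    -- otherwise.
    outflow-separatingForests : ∀ j u →
      outflow G (λ v → f v j) u ≡ (τ + τ) * (1ℚ - δ j u) - D u * κ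
    outflow-separatingForests j u = begin
      O                               ≡⟨ solve 2 (λ o x → o := (o :+ x) :- x) refl O (D u * κ) ⟩
      (O + D u * κ) - D u * κ         ≡⟨ cong (λ x → (O + x) - D u * κ) degree-sum ⟩
      (O + sum edgeTerm) - D u * κ    ≡⟨ cong (_- D u * κ) (∑-distrib-+ drop edgeTerm) ⟨
      sum (λ w → drop w + edgeTerm w) - D u * κ ≡⟨ cong (_- D u * κ) (sum-cong-≗ triangle) ⟩
      sum (λ w → cut w + cut w) - D u * κ  ≡⟨ cong (_- D u * κ) (∑-distrib-+ cut cut) ⟩
      (sum cut + sum cut) - D u * κ   ≡⟨ cong (λ x → (x + x) - D u * κ) sum-cut ⟩
      (τ * (1ℚ - δ j u) + τ * (1ℚ - δ j u)) - D u * κ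
        ≡⟨ solve 3 (λ t d x → (t :* d :+ t :* d) :- x := (t :+ t) :* d :- x) refl τ (1ℚ - δ j u) (D u * κ) ⟩
      (τ + τ) * (1ℚ - δ j u) - D u * κ ∎
      where
      open ≡-Reasoning
      drop edgeTerm cut : Fin n → ℚ
      drop w = if does (u ~? w) then f u j - f w j else 0ℚ
      edgeTerm w = if does (u ~? w) then κ else 0ℚ
      cut w = if does (u ~? w) then f₃ u w j else 0ℚ
      O = sum drop
      degree-sum : D u * κ ≡ sum edgeTerm
      degree-sum = trans (cong (_* κ) (length-filter-tabulate (u ~?_) id))
        (trans (*-distribʳ-sum κ (λ w → ⟦ u ~? w ⟧)) (sum-cong-≗ term))
        where
        term : ∀ w → ⟦ u ~? w ⟧ * κ ≡ edgeTerm w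
        term w with u ~? w
        ... | yes _ = *-identityˡ κ
        ... | no _  = *-zeroˡ κ
      triangle : ∀ w → drop w + edgeTerm w ≡ cut w + cut w
      triangle w with u ~? w
      ... | no _    = refl
      ... | yes u~w = begin
        (f u j - f w j) + κ                 ≡⟨ cong ((f u j - f w j) +_) (separatingForests-adjacent u~w) ⟨
        (f u j - f w j) + f u w             ≡⟨ solve 3 (λ a b c → (a :- b) :+ c := (a :+ c) :- b) refl (f u j) (f w j) (f u w) ⟩
        (f u j + f u w) - f w j             ≡⟨ cong (_- f w j) (separatingForests-triangle {g = endpoints G} u w j) ⟩
        ((f₃ u w j + f₃ u w j) + f w j) - f w j ≡⟨ solve 2 (λ a b → (a :+ b) :- b := a) refl (f₃ u w j + f₃ u w j) (f w j) ⟩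
        f₃ u w j + f₃ u w j                 ∎
      sum-cut : sum cut ≡ τ * (1ℚ - δ j u)
      sum-cut with j ≟ u
      ... | yes refl = trans (sum-zero {n} zeros) (sym (*-zeroʳ τ))
        where
        zeros : ∀ w → cut w ≡ 0ℚ
        zeros w with u ~? w
        ... | yes _ = separatingForests₃-refl {g = endpoints G} u w
        ... | no _  = refl
      ... | no j≢u = trans
        (sum-separatingForests₃ _~?_ (λ {e} → joins⇒~ G {e}) (~⇒joins G) (joins-noParallel G) (j≢u ∘ sym))
        (sym (*-identityʳ τ))

    -- Kirchhoff's formula: the resistance is f i j / τ, here written (h + h) * f i j
    -- with 2 h τ = 1.
    module _ (h : ℚ) (inverse : h * (τ + τ) ≡ 1ℚ) where

      potential : Fin n → Fin n → Fin n → ℚ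
      potential i j v = h * (f v j - f v i)

      -- In the difference of two columns of `f` the degree terms and the constants cancel; only the
      -- two point sources remain, with strength `τ + τ`, and `h` normalises them.
      outflow-potential : ∀ i j u → outflow G (potential i j) u ≡ δ i u - δ j u
      outflow-potential i j u = begin
        outflow G (potential i j) u
          ≡⟨ outflow-scale G h (λ v → f v j) (λ v → f v i) u ⟩
        h * (outflow G (λ v → f v j) u - outflow G (λ v → f v i) u)
          ≡⟨ cong₂ (λ x y → h * (x - y)) (outflow-separatingForests j u) (outflow-separatingForests i u) ⟩
        h * (((τ + τ) * (1ℚ - δ j u) - D u * κ) - ((τ + τ) * (1ℚ - δ i u) - D u * κ))
          ≡⟨ solve 5 (λ h t a b d → h :* ((t :* (con 1ℚ :- b) :- d) :- (t :* (con 1ℚ :- a) :- d))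
                                    := (h :* t) :* (a :- b)) refl h (τ + τ) (δ i u) (δ j u) (D u * κ) ⟩
        (h * (τ + τ)) * (δ i u - δ j u) ≡⟨ cong (_* (δ i u - δ j u)) inverse ⟩
        1ℚ * (δ i u - δ j u)            ≡⟨ *-identityˡ (δ i u - δ j u) ⟩
        δ i u - δ j u                   ∎
        where
        open ≡-Reasoning

      -- The diagonal of `f` is zero and `f` is symmetric, so the drop picks up `f i j` twice.
      potential-drop : ∀ i j → (h + h) * f i j ≡ potential i j i - potential i j j
      potential-drop i j = begin
        (h + h) * f i j
          ≡⟨ solve 2 (λ h x → (h :+ h) :* x := h :* (x :- con 0ℚ) :- h :* (con 0ℚ :- x)) refl h (f i j) ⟩
        h * (f i j - 0ℚ) - h * (0ℚ - f i j)
          ≡⟨ cong₂ (λ x y → h * (f i j - x) - h * (y - f i j))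
                   (sym (separatingForests-refl {g = endpoints G} i)) (sym (separatingForests-refl {g = endpoints G} j)) ⟩
        h * (f i j - f i i) - h * (f j j - f i j)
          ≡⟨ cong (λ x → h * (f i j - f i i) - h * (f j j - x)) (separatingForests-sym {g = endpoints G} i j) ⟩
        h * (f i j - f i i) - h * (f j j - f j i) ∎
        where
        open ≡-Reasoning

      effectiveResistance : ∀ i j → IsEffectiveResistance G i j ((h + h) * f i j)
      effectiveResistance i j = potential i j , outflow-potential i j , potential-drop i j

      -- Two potentials with the same outflow differ by a harmonic function, which is constant, so
      -- they have the same drop.
      effectiveResistance-unique : ∀ {i j r} → IsEffectiveResistance G i j r → r ≡ (h + h) * f i j
      effectiveResistance-unique {i} {j} {r} (φ , kirchhoff , r≡) = begin
        r                               ≡⟨ r≡ ⟩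
        -- The factor 1 brings the difference of the potentials into the form of `outflow-scale`.
        φ i - φ j                       ≡⟨ solve 4 (λ a b x y → a :- b := con 1ℚ :* (a :- x) :+ (x :- b)) refl (φ i) (φ j) (ψ i) (ψ j) ⟩
        1ℚ * (φ i - ψ i) + (ψ i - φ j)  ≡⟨ cong (_+ (ψ i - φ j)) (harmonic⇒constant G conn (λ v → 1ℚ * (φ v - ψ v)) harmonic i j) ⟩
        1ℚ * (φ j - ψ j) + (ψ i - φ j)  ≡⟨ solve 3 (λ b x y → con 1ℚ :* (b :- y) :+ (x :- b) := x :- y) refl (φ j) (ψ i) (ψ j) ⟩
        ψ i - ψ j                       ≡⟨ potential-drop i j ⟨
        (h + h) * f i j                 ∎
        where
        open ≡-Reasoning
        ψ = potential i j
        harmonic : ∀ u → outflow G (λ v → 1ℚ * (φ v - ψ v)) u ≡ 0ℚ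
        harmonic u = begin
          outflow G (λ v → 1ℚ * (φ v - ψ v)) u    ≡⟨ outflow-scale G 1ℚ φ ψ u ⟩
          1ℚ * (outflow G φ u - outflow G ψ u)    ≡⟨ cong₂ (λ x y → 1ℚ * (x - y)) (kirchhoff u) (outflow-potential i j u) ⟩
          1ℚ * ((δ i u - δ j u) - (δ i u - δ j u)) ≡⟨ cong (1ℚ *_) (+-inverseʳ (δ i u - δ j u)) ⟩
          1ℚ * 0ℚ                                 ≡⟨ *-zeroʳ 1ℚ ⟩
          0ℚ                                      ∎

    -- Sum the outflows of the columns of `f` over all sinks `j`. The sink `j` equal to `u` lacks
    -- its source term, whence the subtracted `τ + τ`.
    outflow-ρ : ∀ u → outflow G ρ u ≡ (N * (τ + τ) - (τ + τ)) - N * (D u * κ)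
    outflow-ρ u = begin
      outflow G ρ u                                          ≡⟨ outflow-∑ G (λ j v → f v j) u ⟩
      sum (λ j → outflow G (λ v → f v j) u)                  ≡⟨ sum-cong-≗ (λ j → outflow-separatingForests j u) ⟩
      sum (λ j → (τ + τ) * (1ℚ - δ j u) - D u * κ)           ≡⟨ sum-distrib-- (λ j → (τ + τ) * (1ℚ - δ j u)) (λ _ → D u * κ) ⟩
      sum (λ j → (τ + τ) * (1ℚ - δ j u)) - sum {n} (λ _ → D u * κ)
        ≡⟨ cong₂ _-_ (sym (*-distribˡ-sum (τ + τ) (λ j → 1ℚ - δ j u))) (sum-const n (D u * κ)) ⟩
      (τ + τ) * sum (λ j → 1ℚ - δ j u) - N * (D u * κ)       ≡⟨ cong (λ x → (τ + τ) * x - N * (D u * κ)) sum-1-δ ⟩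
      (τ + τ) * (N - 1ℚ) - N * (D u * κ)
        ≡⟨ solve 3 (λ t m x → t :* (m :- con 1ℚ) :- x := (m :* t :- t) :- x) refl (τ + τ) N (N * (D u * κ)) ⟩
      (N * (τ + τ) - (τ + τ)) - N * (D u * κ)                ∎
      where
      open ≡-Reasoning
      sum-1-δ : sum (λ j → 1ℚ - δ j u) ≡ N - 1ℚ
      sum-1-δ = trans (sum-distrib-- (λ _ → 1ℚ) (λ j → δ j u))
        (cong₂ _-_ (sum-replicate n) (sum-⟦∃!⟧ (_≟ u) (u , refl) λ i≡u j≡u → trans i≡u (sym j≡u)))

    ρ-constant⇔degreeRegular : (∀ i j → ρ i ≡ ρ j) ⇔ DegreeRegular G
    ρ-constant⇔degreeRegular = mk⇔ to from
      where
      open ≡-Reasoning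
      N≢0 : N ≢ 0ℚ
      N≢0 N≡0 = ℕ.≢-nonZero⁻¹ n {{IsConnected.nonEmpty conn}} (·1-injective n 0 N≡0)
      balance : (∀ i j → ρ i ≡ ρ j) → ∀ u → N * (D u * κ) ≡ N * (τ + τ) - (τ + τ)
      balance ρ-constant u = sym (x∙y⁻¹≈ε⇒x≈y (N * (τ + τ) - (τ + τ)) (N * (D u * κ))
        (trans (sym (outflow-ρ u)) (constant⇒harmonic G ρ-constant u)))
      to : (∀ i j → ρ i ≡ ρ j) → DegreeRegular G
      -- By `balance` the product of `N`, `D u` and `κ` is the same for all `u`; recovering the
      -- degree requires cancelling `κ`.
      to ρ-constant u v with κ ≟ℚ 0ℚ
      ... | no κ≢0 = ·1-injective (degree G u) (degree G v)
        (*-cancelˡ-≡ κ≢0 (trans (*-comm κ (D u)) (trans (*-cancelˡ-≡ N≢0 NDκ) (*-comm (D v) κ))))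
        where NDκ = trans (balance ρ-constant u) (sym (balance ρ-constant v))
      -- If no spanning tree has an edge, then n = 1.
      ... | yes κ≡0 = cong (degree G) (Fin-unique (·1-injective n 1 (*-cancelˡ-≡ 2τ≢0 (begin
        (τ + τ) * N             ≡⟨ solve 2 (λ t m → t :* m := (m :* t :- t) :+ t) refl (τ + τ) N ⟩
        (N * (τ + τ) - (τ + τ)) + (τ + τ) ≡⟨ cong (_+ (τ + τ)) (balance ρ-constant u) ⟨
        N * (D u * κ) + (τ + τ) ≡⟨ cong (λ x → N * (D u * x) + (τ + τ)) κ≡0 ⟩
        N * (D u * 0ℚ) + (τ + τ) ≡⟨ solve 3 (λ m d t → m :* (d :* con 0ℚ) :+ t := t :* con 1ℚ) refl N (D u) (τ + τ) ⟩
        (τ + τ) * 1ℚ            ∎))) u v)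
      from : DegreeRegular G → ∀ i j → ρ i ≡ ρ j
      -- For equal degrees the outflow of `ρ` is the same at all vertices, so `N` times it is the
      -- total outflow, which is 0.
      from regular = harmonic⇒constant G conn ρ λ u → *-cancelˡ-≡ N≢0 (begin
        N * outflow G ρ u            ≡⟨ sum-const n (outflow G ρ u) ⟨
        sum {n} (λ _ → outflow G ρ u) ≡⟨ sum-cong-≗ (λ v → outflow-constant u v) ⟩
        sum (outflow G ρ)            ≡⟨ sum-outflow G ρ ⟩
        0ℚ                           ≡⟨ *-zeroʳ N ⟨
        N * 0ℚ                       ∎)
        where
        outflow-constant : ∀ u v → outflow G ρ u ≡ outflow G ρ v
        outflow-constant u v = begin
          outflow G ρ u                           ≡⟨ outflow-ρ u ⟩
          (N * (τ + τ) - (τ + τ)) - N * (D u * κ)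
            ≡⟨ cong (λ d → (N * (τ + τ) - (τ + τ)) - N * (d · 1ℚ * κ)) (regular u v) ⟩
          (N * (τ + τ) - (τ + τ)) - N * (D v * κ) ≡⟨ outflow-ρ v ⟨
          outflow G ρ v                           ∎

    -- Every resistance matrix has the entries `(h + h) * f i j`, so its row sums are those of `f`
    -- times a nonzero constant.
    resistanceRegular⇔ρ-constant : ResistanceRegular G ⇔ (∀ i j → ρ i ≡ ρ j)
    resistanceRegular⇔ρ-constant = mk⇔ to from
      where
      open ≡-Reasoning
      instance _ = ≢-nonZero 2τ≢0
      h = 1/ (τ + τ)
      inverse : h * (τ + τ) ≡ 1ℚ
      inverse = *-inverseˡ (τ + τ)
      2h≢0 : h + h ≢ 0ℚ
      2h≢0 2h≡0 = contradiction (begin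
        1ℚ          ≡⟨ inverse ⟨
        h * (τ + τ) ≡⟨ solve 2 (λ h t → h :* (t :+ t) := (h :+ h) :* t) refl h τ ⟩
        (h + h) * τ ≡⟨ cong (_* τ) 2h≡0 ⟩
        0ℚ * τ      ≡⟨ *-zeroˡ τ ⟩
        0ℚ          ∎) λ ()
      to : ResistanceRegular G → ∀ i j → ρ i ≡ ρ j
      to (R , resistance , regular) i j = *-cancelˡ-≡ 2h≢0 (begin
        (h + h) * ρ i ≡⟨ rowSum i ⟨
        sum (R i)     ≡⟨ regular i j ⟩
        sum (R j)     ≡⟨ rowSum j ⟩
        (h + h) * ρ j ∎)
        where
        rowSum : ∀ i → sum (R i) ≡ (h + h) * ρ i
        rowSum i = trans (sum-cong-≗ λ j → effectiveResistance-unique h inverse (resistance i j))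
                         (sym (*-distribˡ-sum (h + h) (f i)))
      from : (∀ i j → ρ i ≡ ρ j) → ResistanceRegular G
      from ρ-constant = (λ i j → (h + h) * f i j) , effectiveResistance h inverse , λ i j → begin
        sum (λ k → (h + h) * f i k) ≡⟨ *-distribˡ-sum (h + h) (f i) ⟨
        (h + h) * ρ i               ≡⟨ cong ((h + h) *_) (ρ-constant i j) ⟩
        (h + h) * ρ j               ≡⟨ *-distribˡ-sum (h + h) (f j) ⟩
        sum (λ k → (h + h) * f j k) ∎

theorem2p25 : (n : ℕ) (G : Graph n) → Connected G → Equiarboreal G →
    ResistanceRegular G ⇔ DegreeRegular G
theorem2p25 n G conn (k , treesThrough) =
  ρ-constant⇔degreeRegular G conn k treesThrough ⇔-∘
  resistanceRegular⇔ρ-constant G conn k treesThrough
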